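{- Let $r$ be an even positive integer and $k$ a positive integer. In the game King, the Sprague-Grundy value of the generalized staircase $[(kr)^r,((k-1)r)^r,\ldots,r^r]$ is $2$ if $k=1$, and $1$ otherwise.
   Context: A partition is a finite weakly decreasing sequence $\lambda=[\lambda_1,\ldots,\lambda_s]$ of positive integers (exponents denote repetition of parts; $[\,]$ is the empty partition). For $i,j\ge 0$, $\lambda[i,j]=[\lambda_{i+1}-j,\lambda_{i+2}-j,\ldots]$ with trailing nonpositive entries removed. King is the impartial game whose positions are nonempty partitions; from $\mu$ a player may move to $\mu[a,b]$ for any $(a,b)\in\{(0,1),(1,0),(1,1)\}$ with $\mu[a,b]\ne[\,]$. The Sprague-Grundy value of a position is the mex (least nonnegative integer not in the set) of the Sprague-Grundy values of the positions reachable in one move (so $0$ for terminal positions). -}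

module Defs where

open import Data.Empty using (⊥-elim-irr)
open import Data.List.Base using (List; []; _∷_; _++_; map; filter; drop; replicate; mapMaybe)
open import Data.List.Extrema.Nat using (max; xs≤max)
open import Data.List.Membership.Propositional using (_∈_; _∉_; mapWith∈)
open import Data.List.Membership.Propositional.Properties using (mapWith∈-cong; mapWith∈≗map)
open import Data.List.Relation.Unary.All as All using (All; []; _∷_)
open import Data.List.Relation.Unary.All.Properties as Allₚ using (all-filter)
open import Data.List.Relation.Unary.AllPairs using (AllPairs; []; _∷_)
open import Data.List.Relation.Unary.AllPairs.Properties as AllPairsₚ using ()
open import Data.List.Relation.Unary.Linked as Linked using (Linked)
open import Data.List.Relation.Unary.Linked.Properties as Linkedₚ using (AllPairs⇒Linked; Linked⇒AllPairs)
open import Data.Maybe.Base using (Maybe; just; nothing)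
open import Data.Maybe.Relation.Unary.All as MaybeAll using (just; nothing)
open import Data.Nat.Base
open import Data.Nat.Induction using (<-wellFounded)
open import Data.Nat.ListAction using (sum)
open import Data.Nat.Properties
open import Data.List.Membership.DecPropositional _≟_ using (_∈?_)
open import Data.Product.Base using (_×_; _,_)
open import Data.Sum.Base using ([_,_])
open import Induction.WellFounded using (Acc; acc)
open import Relation.Binary.PropositionalEquality using (_≡_; _≢_; refl; sym; trans; cong; subst)
open import Relation.Nullary using (yes; no; contradiction)

-- The proof fields are irrelevant, so partitions with the same parts are
-- definitionally equal.

record Partition : Set where
  constructor partition
  field
    parts              : List ℕ
    .weaklyDecreasing  : Linked _≥_ parts
    .positive          : All (0 <_) parts

open Partition public using (parts)

-- Truncated subtraction sends every nonpositive difference to 0.  As the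
-- sequence is weakly decreasing, the zeros are exactly the trailing entries to
-- be removed.

truncate : ℕ → ℕ → List ℕ → List ℕ
truncate i j xs = filter (0 <?_) (map (_∸ j) (drop i xs))

private
  ≥-trans : ∀ {x y z} → x ≥ y → y ≥ z → x ≥ z
  ≥-trans x≥y y≥z = ≤-trans y≥z x≥y

  truncate-decreasing : ∀ i j {xs} → Linked _≥_ xs → Linked _≥_ (truncate i j xs)
  truncate-decreasing i j xs↘ =
    Linkedₚ.filter⁺ (0 <?_) ≥-trans
      (Linkedₚ.map⁺
        (Linked.map (∸-monoˡ-≤ j)
          (AllPairs⇒Linked (AllPairsₚ.drop⁺ i (Linked⇒AllPairs ≥-trans xs↘)))))

-- subpartition i j λ is the partition usually written λ[i,j].

subpartition : ℕ → ℕ → Partition → Partition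
subpartition i j (partition xs xs↘ _) =
  partition (truncate i j xs)
            (truncate-decreasing i j xs↘)
            (all-filter (0 <?_) (map (_∸ j) (drop i xs)))

record Position : Set where
  constructor position
  field
    shape      : Partition
    .nonempty  : parts shape ≢ []

open Position public using (shape)

asPosition : Partition → Maybe Position
asPosition (partition []       _  _ ) = nothing
asPosition (partition (x ∷ xs) ↘  >0) = just (position (partition (x ∷ xs) ↘ >0) λ ())

moves : List (ℕ × ℕ)
moves = (0 , 1) ∷ (1 , 0) ∷ (1 , 1) ∷ []

-- move μ (a , b) is nothing when μ[a,b] is empty, since that move is not allowed.

move : Position → ℕ × ℕ → Maybe Position
move μ (a , b) = asPosition (subpartition a b (shape μ))

options : Position → List Position
options μ = mapMaybe (move μ) moves

-- firstMissing xs n f is the least of n, n + 1, …, n + f - 1 that is not in xs,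
-- and n + f if there is none.

firstMissing : List ℕ → ℕ → ℕ → ℕ
firstMissing xs n zero    = n
firstMissing xs n (suc f) with n ∈? xs
... | yes _ = firstMissing xs (suc n) f
... | no  _ = n

-- The bound suffices: suc (max 0 xs) is never in xs.

mex : List ℕ → ℕ
mex xs = firstMissing xs 0 (suc (max 0 xs))

private
  firstMissing-∉ : ∀ xs n f → (n + f) ∉ xs → firstMissing xs n f ∉ xs
  firstMissing-∉ xs n zero    n+f∉ n∈ = n+f∉ (subst (_∈ xs) (sym (+-identityʳ n)) n∈)
  firstMissing-∉ xs n (suc f) n+f∉ with n ∈? xs
  ... | yes _  = firstMissing-∉ xs (suc n) f (subst (_∉ xs) (+-suc n f) n+f∉)
  ... | no  n∉ = n∉

  firstMissing-least : ∀ xs n f {m} → n ≤ m → m < firstMissing xs n f → m ∈ xs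
  firstMissing-least xs n zero    n≤m m<n = contradiction n≤m (<⇒≱ m<n)
  firstMissing-least xs n (suc f) n≤m m<r with n ∈? xs
  ... | no  _  = contradiction n≤m (<⇒≱ m<r)
  ... | yes n∈ =
    [ (λ n<m → firstMissing-least xs (suc n) f n<m m<r)
    , (λ n≡m → subst (_∈ xs) n≡m n∈)
    ] (m≤n⇒m<n∨m≡n n≤m)

mex-∉ : ∀ xs → mex xs ∉ xs
mex-∉ xs = firstMissing-∉ xs 0 (suc (max 0 xs))
  λ max∈ → <-irrefl refl (All.lookup (xs≤max 0 xs) max∈)

mex-least : ∀ xs {m} → m < mex xs → m ∈ xs
mex-least xs = firstMissing-least xs 0 (suc (max 0 xs)) z≤n

size : Position → ℕ
size μ = sum (parts (shape μ))

private
  sum-filter : ∀ xs → sum (filter (0 <?_) xs) ≤ sum xs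
  sum-filter []           = z≤n
  sum-filter (zero  ∷ xs) = sum-filter xs
  sum-filter (suc x ∷ xs) = +-monoʳ-≤ (suc x) (sum-filter xs)

  sum-map-∸ : ∀ j xs → sum (map (_∸ j) xs) ≤ sum xs
  sum-map-∸ j []       = z≤n
  sum-map-∸ j (x ∷ xs) = +-mono-≤ (m∸n≤m x j) (sum-map-∸ j xs)

  sum-truncate : ∀ j xs → sum (truncate 0 j xs) ≤ sum xs
  sum-truncate j xs = ≤-trans (sum-filter (map (_∸ j) xs)) (sum-map-∸ j xs)

  asPosition-size : ∀ ν {n} → sum (parts ν) < n → MaybeAll.All (λ μ → size μ < n) (asPosition ν)
  asPosition-size (partition []      _ _) _   = nothing
  asPosition-size (partition (_ ∷ _) _ _) s<n = just s<n

  options-size : ∀ μ → All (λ ν → size ν < size μ) (options μ)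
  options-size (position (partition [] _ _) ne) = ⊥-elim-irr (ne refl)
  options-size (position (partition (zero ∷ _) _ >0) _) = ⊥-elim-irr (<-irrefl refl (All.head >0))
  options-size p@(position μ@(partition (suc x ∷ xs) _ _) _) = Allₚ.mapMaybe⁺ {xs = moves} {f = move p}
    ( asPosition-size (subpartition 0 1 μ)
        (s≤s (≤-trans (sum-filter (x ∷ map (_∸ 1) xs)) (+-monoʳ-≤ x (sum-map-∸ 1 xs))))
    ∷ asPosition-size (subpartition 1 0 μ) (s≤s (≤-trans (sum-truncate 0 xs) (m≤n+m _ x)))
    ∷ asPosition-size (subpartition 1 1 μ) (s≤s (≤-trans (sum-truncate 1 xs) (m≤n+m _ x)))
    ∷ [])

grundyAcc : ∀ μ → Acc _<_ (size μ) → ℕ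
grundyAcc μ (acc rs) =
  mex (mapWith∈ (options μ) λ {ν} ν∈ → grundyAcc ν (rs (All.lookup (options-size μ) ν∈)))

grundy : Position → ℕ
grundy μ = grundyAcc μ (<-wellFounded (size μ))

private
  grundyAcc-irrelevant : ∀ μ (p q : Acc _<_ (size μ)) → grundyAcc μ p ≡ grundyAcc μ q
  grundyAcc-irrelevant μ (acc rs) (acc rs′) =
    cong mex (mapWith∈-cong (options μ) _ _ λ ν∈ → grundyAcc-irrelevant _ (rs _) (rs′ _))

grundy-mex : ∀ μ → grundy μ ≡ mex (map grundy (options μ))
grundy-mex μ = trans (unfold (<-wellFounded (size μ))) (cong mex (mapWith∈≗map grundy (options μ)))
  where
  unfold : (p : Acc _<_ (size μ)) →
           grundyAcc μ p ≡ mex (mapWith∈ (options μ) λ {ν} _ → grundy ν)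
  unfold (acc rs) =
    cong mex (mapWith∈-cong (options μ) _ _ λ ν∈ → grundyAcc-irrelevant _ (rs _) (<-wellFounded _))

-- staircaseParts r k is [(kr)^r, ((k-1)r)^r, …, r^r].

staircaseParts : ℕ → ℕ → List ℕ
staircaseParts r zero    = []
staircaseParts r (suc k) = replicate r (suc k * r) ++ staircaseParts r k

private
  staircaseParts-≤ : ∀ r k → All (_≤ k * r) (staircaseParts r k)
  staircaseParts-≤ r zero    = []
  staircaseParts-≤ r (suc k) = Allₚ.++⁺ (Allₚ.replicate⁺ r ≤-refl)
    (All.map (λ x≤ → ≤-trans x≤ (m≤n+m (k * r) r)) (staircaseParts-≤ r k))

  replicate-pairs : ∀ n x → AllPairs _≥_ (replicate n x)
  replicate-pairs zero    x = []
  replicate-pairs (suc n) x = Allₚ.replicate⁺ n ≤-refl ∷ replicate-pairs n x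

  staircaseParts-pairs : ∀ r k → AllPairs _≥_ (staircaseParts r k)
  staircaseParts-pairs r zero    = []
  staircaseParts-pairs r (suc k) =
    AllPairsₚ.++⁺ (replicate-pairs r (suc k * r)) (staircaseParts-pairs r k)
      (Allₚ.replicate⁺ r (All.map (λ x≤ → ≤-trans x≤ (m≤n+m (k * r) r)) (staircaseParts-≤ r k)))

  staircaseParts-positive : ∀ r k → .{{NonZero r}} → All (0 <_) (staircaseParts r k)
  staircaseParts-positive r       zero    = []
  staircaseParts-positive (suc r) (suc k) =
    Allₚ.++⁺ (Allₚ.replicate⁺ (suc r) z<s) (staircaseParts-positive (suc r) k)

  staircaseParts-nonempty : ∀ r k → .{{NonZero r}} → .{{NonZero k}} → staircaseParts r k ≢ []
  staircaseParts-nonempty (suc r) (suc k) ()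

staircase : ∀ r k → .{{NonZero r}} → .{{NonZero k}} → Position
staircase r k = position
  (partition (staircaseParts r k)
             (AllPairs⇒Linked (staircaseParts-pairs r k))
             (staircaseParts-positive r k))
  (staircaseParts-nonempty r k)

{-# OPTIONS --safe #-}

-- The positions reachable from λ are the cells (i, j) of its Young diagram, and
-- a move is a king's step down, right or diagonally inside the diagram.  For
-- r = 2m the diagram splits into 2×2 blocks, whose lower right cell always has
-- value 0.  Hence the other three values of a block depend only on the blocks
-- to the right and below, and they turn out to be determined by the number of
-- the r×r square containing the block, counted from the rim, and by the position
-- of the block relative to the diagonal of that square.  In the k-th square from
-- the rim the upper left value is 2 if k = 1, and 1 otherwise.

module Submission where

open import Data.Empty using (⊥-elim-irr)
open import Data.List.Base using (List; []; _∷_; _++_; catMaybes; filter; map; replicate)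
open import Data.List.Properties
  using (filter-all; filter-++; filter-none; map-++; map-catMaybes; map-id; map-replicate)
open import Data.List.Relation.Unary.All as All using (All; []; _∷_)
open import Data.List.Relation.Unary.All.Properties as Allₚ using ()
open import Data.Maybe.Base as Maybe using (Maybe; just; nothing)
open import Data.Maybe.Properties using (just-injective)
open import Data.Maybe.Relation.Unary.All as MaybeAll using (just; nothing)
open import Data.Nat.Base
open import Data.Nat.Divisibility using (_∣_; divides)
open import Data.Nat.Properties
open import Data.Product.Base using (_×_; _,_)
open import Function.Base using (id)
open import Relation.Binary.PropositionalEquality
  using (_≡_; _≢_; refl; trans; cong; cong₂; subst)
open import Relation.Nullary using (contradiction)
open import Defs

-- Values and truncations of lists of parts.

-- The value of the empty partition, which is not a position, is nothing.

HasValue : List ℕ → Maybe ℕ → Set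
HasValue xs v = ∀ ν → parts ν ≡ xs → Maybe.map grundy (asPosition ν) ≡ v

hasValue-≡ : ∀ {xs ys v} → xs ≡ ys → HasValue ys v → HasValue xs v
hasValue-≡ refl h = h

hasValue-[] : HasValue [] nothing
hasValue-[] (partition _ _ _) refl = refl

-- A move to the empty partition contributes `nothing`, and `catMaybes` discards it just as
-- `mapMaybe` does in `options`.
hasValue-mex : ∀ {x xs u v w} → HasValue (truncate 0 1 (x ∷ xs)) u →
               HasValue (truncate 1 0 (x ∷ xs)) v → HasValue (truncate 1 1 (x ∷ xs)) w →
               HasValue (x ∷ xs) (just (mex (catMaybes (u ∷ v ∷ w ∷ []))))
hasValue-mex {x} {xs} {u} {v} {w} hu hv hw ν@(partition _ ↘ >0) refl =
  cong just (trans (grundy-mex μ) (cong mex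
    (trans (map-catMaybes grundy (map (move μ) moves)) (cong catMaybes eq))))
  where
  μ : Position
  μ = position ν λ ()

  eq : map (Maybe.map grundy) (map (move μ) moves) ≡ u ∷ v ∷ w ∷ []
  eq = cong₂ _∷_ (hu (subpartition 0 1 ν) refl)
         (cong₂ _∷_ (hv (subpartition 1 0 ν) refl)
           (cong (_∷ []) (hw (subpartition 1 1 ν) refl)))

grundy-hasValue : ∀ μ {v} → HasValue (parts (shape μ)) (just v) → grundy μ ≡ v
grundy-hasValue (position (partition [] _ _) ne)        _ = ⊥-elim-irr (ne refl)
grundy-hasValue (position ν@(partition (_ ∷ _) _ _) _) h = just-injective (h ν refl)

mex≡0 : ∀ {xs} → All (0 <_) xs → mex xs ≡ 0
mex≡0 {xs} >0 = n≤0⇒n≡0 (≮⇒≥ λ 0<mex → <-irrefl refl (All.lookup >0 (mex-least xs 0<mex)))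

truncate-++ : ∀ j xs ys → truncate 0 j (xs ++ ys) ≡ truncate 0 j xs ++ truncate 0 j ys
truncate-++ j xs ys =
  trans (cong (filter (0 <?_)) (map-++ (_∸ j) xs ys)) (filter-++ (0 <?_) (map (_∸ j) xs) _)

truncate-positive : ∀ {xs} → All (0 <_) xs → truncate 0 0 xs ≡ xs
truncate-positive {xs} >0 = trans (cong (filter (0 <?_)) (map-id xs)) (filter-all (0 <?_) >0)

truncate-replicate-suc : ∀ n x → truncate 0 1 (replicate n (suc (suc x))) ≡ replicate n (suc x)
truncate-replicate-suc n x =
  trans (cong (filter (0 <?_)) (map-replicate (_∸ 1) n _)) (filter-all (0 <?_) (Allₚ.replicate⁺ n z<s))

truncate-replicate-one : ∀ n → truncate 0 1 (replicate n 1) ≡ []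
truncate-replicate-one n =
  trans (cong (filter (0 <?_)) (map-replicate (_∸ 1) n _)) (filter-none (0 <?_) (Allₚ.replicate⁺ n λ ()))

-- Values in a block and their mex identities.

-- The r×r squares on the rim have phase first; the following antidiagonals of
-- squares alternate between even and odd.

data Phase : Set where
  first even odd : Phase

next : Phase → Phase
next first = even
next even  = odd
next odd   = even

phase : ℕ → Phase
phase zero    = first
phase (suc L) = next (phase L)

-- inner is the upper left value of a block.  The upper right value of block
-- (X , Y) is side φ X Y, which is near φ if Y ≤ X and far φ otherwise, and its
-- lower left value is side φ Y X.

inner near far : Phase → ℕ
inner first = 2
inner even  = 1
inner odd   = 1
near  first = 1
near  even  = 3
near  odd   = 2
far   first = 3
far   even  = 2
far   odd   = 3

side : Phase → ℕ → ℕ → ℕ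
side φ X       zero    = near φ
side φ zero    (suc Y) = far φ
side φ (suc X) (suc Y) = side φ X Y

inner>0 : ∀ φ → 0 < inner φ
inner>0 first = z<s
inner>0 even  = z<s
inner>0 odd   = z<s

side>0 : ∀ φ X Y → 0 < side φ X Y
side>0 first X zero = z<s
side>0 even  X zero = z<s
side>0 odd   X zero = z<s
side>0 first zero (suc Y) = z<s
side>0 even  zero (suc Y) = z<s
side>0 odd   zero (suc Y) = z<s
side>0 φ (suc X) (suc Y) = side>0 φ X Y

side-near : ∀ φ {X Y} → Y ≤ X → side φ X Y ≡ near φ
side-near φ z≤n       = refl
side-near φ (s≤s Y≤X) = side-near φ Y≤X

-- One of the two sides is `near φ`, and `inner φ` is the least positive number other than `near φ`;
-- it also differs from `far φ`.
mex-inner : ∀ φ X Y → mex (side φ X Y ∷ side φ Y X ∷ 0 ∷ []) ≡ inner φ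
mex-inner first zero zero = refl
mex-inner even  zero zero = refl
mex-inner odd   zero zero = refl
mex-inner first zero (suc Y) = refl
mex-inner even  zero (suc Y) = refl
mex-inner odd   zero (suc Y) = refl
mex-inner first (suc X) zero = refl
mex-inner even  (suc X) zero = refl
mex-inner odd   (suc X) zero = refl
mex-inner φ (suc X) (suc Y) = mex-inner φ X Y

-- `inner φ`, `near φ` and `far φ` are 1, 2, 3 in some order, so the mex of 0 and two of them is the
-- third. Since X ≤ Y excludes Y + 1 ≤ X, exactly one of `side φ Y X` and `side φ X (suc Y)` is
-- `near φ`.
mex-right : ∀ φ X Y → mex (inner φ ∷ 0 ∷ side φ Y X ∷ []) ≡ side φ X (suc Y)
mex-right first zero Y = refl
mex-right even  zero Y = refl
mex-right odd   zero Y = refl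
mex-right first (suc X) zero = refl
mex-right even  (suc X) zero = refl
mex-right odd   (suc X) zero = refl
mex-right φ (suc X) (suc Y) = mex-right φ X Y

mex-down : ∀ φ X Y → mex (0 ∷ inner φ ∷ side φ X Y ∷ []) ≡ side φ Y (suc X)
mex-down first X zero = refl
mex-down even  X zero = refl
mex-down odd   X zero = refl
mex-down first zero (suc Y) = refl
mex-down even  zero (suc Y) = refl
mex-down odd   zero (suc Y) = refl
mex-down φ (suc X) (suc Y) = mex-down φ X Y

-- The missing value is `far φ`, and the phases are linked by `far φ` = `near (next φ)`.
mex-right-next : ∀ φ → mex (inner φ ∷ 0 ∷ near φ ∷ []) ≡ near (next φ)
mex-right-next first = refl
mex-right-next even  = refl
mex-right-next odd   = refl

mex-down-next : ∀ φ → mex (0 ∷ inner φ ∷ near φ ∷ []) ≡ near (next φ)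
mex-down-next first = refl
mex-down-next even  = refl
mex-down-next odd   = refl

-- Positions inside a staircase and the moves between them.

module _ (M : ℕ) where

  r : ℕ
  r = suc M * 2

  -- For q < r, the staircase with L steps without its first r - (q + 1) columns.
  steps : ℕ → ℕ → List ℕ
  steps q zero    = []
  steps q (suc L) = replicate r (suc q + L * r) ++ steps q L

  -- A position whose first cell lies in a square with L further squares to its
  -- right; in that square n rows remain from this cell on, and q columns after it.
  -- Only n counts the cell itself, so region (suc L) 0 q is region L r q.

  region : ℕ → ℕ → ℕ → List ℕ
  region L n q = replicate n (suc q + L * r) ++ steps q L

  steps-staircase : ∀ k → staircaseParts r k ≡ steps (suc (M * 2)) k
  steps-staircase zero    = refl
  steps-staircase (suc k) = cong (replicate r (suc k * r) ++_) (steps-staircase k)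

  steps-positive : ∀ q L → All (0 <_) (steps q L)
  steps-positive q zero    = []
  steps-positive q (suc L) = Allₚ.++⁺ (Allₚ.replicate⁺ r z<s) (steps-positive q L)

  truncate-down : ∀ L n q → truncate 1 0 (region L (suc n) q) ≡ region L n q
  truncate-down L n q =
    truncate-positive (Allₚ.++⁺ (Allₚ.replicate⁺ n z<s) (steps-positive q L))

  steps-right : ∀ L q → truncate 0 1 (steps (suc q) L) ≡ steps q L
  steps-right zero    q = refl
  steps-right (suc L) q = trans (truncate-++ 1 (replicate r (suc (suc q) + L * r)) _)
    (cong₂ _++_ (truncate-replicate-suc r _) (steps-right L q))

  truncate-right : ∀ L n q → truncate 0 1 (region L n (suc q)) ≡ region L n q
  truncate-right L n q = trans (truncate-++ 1 (replicate n (suc (suc q) + L * r)) _)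
    (cong₂ _++_ (truncate-replicate-suc n _) (steps-right L q))

  truncate-right-last : ∀ n → truncate 0 1 (region 0 n 0) ≡ []
  truncate-right-last n = trans (truncate-++ 1 (replicate n 1) [])
    (cong₂ _++_ (truncate-replicate-one n) refl)

  -- Losing its last column deletes the lowest step, and the step above it then has full width r,
  -- hence the index r - 1. The two claims are mutual because `steps 0 (suc L)` is `region L r 0`.
  steps-right-cross : ∀ L → truncate 0 1 (steps 0 (suc L)) ≡ steps (suc (M * 2)) L
  truncate-right-cross : ∀ L n → truncate 0 1 (region (suc L) n 0) ≡ region L n (suc (M * 2))

  steps-right-cross zero    = truncate-right-last r
  steps-right-cross (suc L) = truncate-right-cross L r

  truncate-right-cross L n = trans (truncate-++ 1 (replicate n (1 + suc L * r)) _)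
    (cong₂ _++_ (truncate-replicate-suc n _) (steps-right-cross L))

  -- Induction over the 2×2 blocks.

  -- X and Y are the numbers of blocks below and to the right within the square.

  record Block (L X Y : ℕ) : Set where
    field
      inner-value  : HasValue (region L (2 + X * 2) (1 + Y * 2)) (just (inner (phase L)))
      right-value  : HasValue (region L (2 + X * 2) (Y * 2)) (just (side (phase L) X Y))
      bottom-value : HasValue (region L (1 + X * 2) (1 + Y * 2)) (just (side (phase L) Y X))
      corner-value : HasValue (region L (1 + X * 2) (Y * 2)) (just 0)

  -- One interface for a neighbour in the same square, one in the next square, and the rim, where
  -- both values are `nothing`.
  record RightNeighbour (L X Y : ℕ) : Set where
    field
      {upper lower} : Maybe ℕ
      upper-value   : HasValue (truncate 0 1 (region L (2 + X * 2) (Y * 2))) upper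
      lower-value   : HasValue (truncate 0 1 (region L (1 + X * 2) (Y * 2))) lower
      upper>0       : MaybeAll.All (0 <_) upper
      lower>0       : MaybeAll.All (0 <_) lower
      mex-upper     : mex (catMaybes (upper ∷ just 0 ∷ lower ∷ [])) ≡ side (phase L) X Y

  record LowerNeighbour (L X Y : ℕ) : Set where
    field
      {left right} : Maybe ℕ
      left-value   : HasValue (region L (X * 2) (1 + Y * 2)) left
      right-value  : HasValue (region L (X * 2) (Y * 2)) right
      right>0      : MaybeAll.All (0 <_) right
      mex-left     : mex (catMaybes (just 0 ∷ left ∷ right ∷ [])) ≡ side (phase L) Y X

  -- This cell is an option of the corner only, so it is enough that its value is not 0.
  record Diagonal (L X Y : ℕ) : Set where
    field
      {diagonal}     : Maybe ℕ
      diagonal-value : HasValue (truncate 0 1 (region L (X * 2) (Y * 2))) diagonal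
      diagonal>0     : MaybeAll.All (0 <_) diagonal

  -- The corner comes first: its options lie in other blocks and none is a corner, so none has value
  -- 0. The right and bottom cells use this 0, and the inner cell uses all three.
  step : ∀ {L X Y} → RightNeighbour L X Y → LowerNeighbour L X Y → Diagonal L X Y → Block L X Y
  step {L} {X} {Y} R D G = record
    { inner-value  = subst (Value (2 + X * 2) (1 + Y * 2)) (mex-inner (phase L) X Y)
        (hasValue-mex (right-to right) (down-to bottom) (right-to corner))
    ; right-value  = right
    ; bottom-value = bottom
    ; corner-value = corner
    }
    where
    module R = RightNeighbour R
    module D = LowerNeighbour D
    module G = Diagonal G

    Value : ℕ → ℕ → ℕ → Set
    Value n q v = HasValue (region L n q) (just v)

    right-to : ∀ {n q v} → HasValue (region L n q) v → HasValue (truncate 0 1 (region L n (suc q))) v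
    right-to {n} {q} = hasValue-≡ (truncate-right L n q)

    down-to : ∀ {n q v} → HasValue (region L n q) v → HasValue (truncate 1 0 (region L (suc n) q)) v
    down-to {n} {q} = hasValue-≡ (truncate-down L n q)

    corner : Value (1 + X * 2) (Y * 2) 0
    corner = subst (Value (1 + X * 2) (Y * 2))
      (mex≡0 (Allₚ.mapMaybe⁺ {xs = R.lower ∷ D.right ∷ G.diagonal ∷ []} {f = id}
        (R.lower>0 ∷ D.right>0 ∷ G.diagonal>0 ∷ [])))
      (hasValue-mex R.lower-value (down-to D.right-value) G.diagonal-value)

    right : Value (2 + X * 2) (Y * 2) (side (phase L) X Y)
    right = subst (Value (2 + X * 2) (Y * 2)) R.mex-upper
      (hasValue-mex R.upper-value (down-to corner) R.lower-value)

    bottom : Value (1 + X * 2) (1 + Y * 2) (side (phase L) Y X)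
    bottom = subst (Value (1 + X * 2) (1 + Y * 2)) D.mex-left
      (hasValue-mex (right-to corner) (down-to D.left-value) (right-to D.right-value))

  -- The recursion is lexicographic in L, X, Y: entering the next square resets X or Y to M but
  -- lowers L.
  block : ∀ L X Y → X ≤ M → Y ≤ M → Block L X Y
  rightNeighbour : ∀ L X Y → X ≤ M → Y ≤ M → RightNeighbour L X Y
  lowerNeighbour : ∀ L X Y → X ≤ M → Y ≤ M → LowerNeighbour L X Y
  diagonal : ∀ L X Y → X ≤ M → Y ≤ M → Diagonal L X Y

  block L X Y X≤M Y≤M =
    step (rightNeighbour L X Y X≤M Y≤M) (lowerNeighbour L X Y X≤M Y≤M) (diagonal L X Y X≤M Y≤M)

  rightNeighbour L X (suc Y) X≤M Y<M = record
    { upper-value = hasValue-≡ (truncate-right L (2 + X * 2) _) B.inner-value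
    ; lower-value = hasValue-≡ (truncate-right L (1 + X * 2) _) B.bottom-value
    ; upper>0     = just (inner>0 (phase L))
    ; lower>0     = just (side>0 (phase L) Y X)
    ; mex-upper   = mex-right (phase L) X Y
    }
    where module B = Block (block L X Y X≤M (<⇒≤ Y<M))
  rightNeighbour (suc L) X zero X≤M Y≤M = record
    { upper-value = hasValue-≡ (truncate-right-cross L (2 + X * 2)) B.inner-value
    ; lower-value = hasValue-≡ (truncate-right-cross L (1 + X * 2)) B.bottom-value
    ; upper>0     = just (inner>0 (phase L))
    ; lower>0     = just (side>0 (phase L) M X)
    -- The neighbour is in the leftmost column of blocks of its square, so X ≤ M makes its lower
    -- left value `near`.
    ; mex-upper   = trans (cong (λ v → mex (inner (phase L) ∷ 0 ∷ v ∷ [])) (side-near (phase L) X≤M))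
                          (mex-right-next (phase L))
    }
    where module B = Block (block L X M X≤M ≤-refl)
  rightNeighbour zero X zero _ _ = record
    { upper-value = hasValue-≡ (truncate-right-last (2 + X * 2)) hasValue-[]
    ; lower-value = hasValue-≡ (truncate-right-last (1 + X * 2)) hasValue-[]
    ; upper>0     = nothing
    ; lower>0     = nothing
    -- Only the corner remains as an option, and the mex 1 of its value 0 is `near first`.
    ; mex-upper   = refl
    }

  lowerNeighbour L (suc X) Y X<M Y≤M = record
    { left-value  = B.inner-value
    ; right-value = B.right-value
    ; right>0     = just (side>0 (phase L) X Y)
    ; mex-left    = mex-down (phase L) X Y
    }
    where module B = Block (block L X Y (<⇒≤ X<M) Y≤M)
  lowerNeighbour (suc L) zero Y X≤M Y≤M = record
    { left-value  = B.inner-value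
    ; right-value = B.right-value
    ; right>0     = just (side>0 (phase L) M Y)
    ; mex-left    = trans (cong (λ v → mex (0 ∷ inner (phase L) ∷ v ∷ [])) (side-near (phase L) Y≤M))
                          (mex-down-next (phase L))
    }
    -- The rows below are `region L r q` with r = 2 + 2M, so the block below has X = M.
    where module B = Block (block L M Y ≤-refl Y≤M)
  lowerNeighbour zero zero Y _ _ = record
    { left-value  = hasValue-[]
    ; right-value = hasValue-[]
    ; right>0     = nothing
    ; mex-left    = refl
    }

  -- The diagonal cell is the upper right neighbour of the block below.
  diagonal L (suc X) Y X<M Y≤M = record { diagonal-value = R.upper-value ; diagonal>0 = R.upper>0 }
    where module R = RightNeighbour (rightNeighbour L X Y (<⇒≤ X<M) Y≤M)
  diagonal (suc L) zero Y X≤M Y≤M = record { diagonal-value = R.upper-value ; diagonal>0 = R.upper>0 }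
    where module R = RightNeighbour (rightNeighbour L M Y ≤-refl Y≤M)
  diagonal zero zero Y _ _ = record { diagonal-value = hasValue-[] ; diagonal>0 = nothing }

-- The value of the full staircase.

grundy-staircase : ∀ r M L → .{{_ : NonZero r}} → r ≡ suc M * 2 →
                   grundy (staircase r (suc L)) ≡ inner (phase L)
grundy-staircase r M L r≡ = grundy-hasValue (staircase r (suc L))
  (hasValue-≡ parts≡ (Block.inner-value (block M L M M ≤-refl ≤-refl)))
  where
  parts≡ : staircaseParts r (suc L) ≡ steps M (suc (M * 2)) (suc L)
  parts≡ = trans (cong (λ r → staircaseParts r (suc L)) r≡) (steps-staircase M (suc L))

inner-phase : ∀ k → .{{_ : NonZero k}} → ∀ {v} → v ≡ inner (phase (pred k)) →
              (k ≡ 1 → v ≡ 2) × (k ≢ 1 → v ≡ 1)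
inner-phase (suc zero)    v≡ = (λ _ → v≡) , λ k≢1 → contradiction refl k≢1
inner-phase (suc (suc L)) v≡ = (λ ()) , λ _ → trans v≡ (inner-next (phase L))
  where
  inner-next : ∀ φ → inner (next φ) ≡ 1
  inner-next first = refl
  inner-next even  = refl
  inner-next odd   = refl

lemma3p14 : (r k : ℕ) → .{{_ : NonZero r}} → .{{_ : NonZero k}} → 2 ∣ r →
    (k ≡ 1 → grundy (staircase r k) ≡ 2) × (k ≢ 1 → grundy (staircase r k) ≡ 1)
lemma3p14 r (suc L) (divides (suc M) r≡) = inner-phase (suc L) (grundy-staircase r M L r≡)
lemma3p14 zero    _ {{()}} (divides zero _)
lemma3p14 (suc _) _ (divides zero ())
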